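{- Let $n,k$ be integers with $1\le k\le \frac n2-1$, and let $T\in\mathcal T_{n,k}$. Put $\Delta=\left\lfloor \frac{n-2}{k}\right\rfloor+1$, $p=\left\lfloor \frac{n-2-k(\Delta-1)}{\Delta-2}\right\rfloor$ and $\mu=n-1-k(\Delta-1)-p(\Delta-2)$. Then $$\prod\nolimits_1(T)\ \ge\ \Delta^{2k}(\Delta-1)^{2p}\mu^{2},$$ and equality holds if and only if the degree sequence of $T$ is $$(\underbrace{\Delta,\ldots,\Delta}_{k},\underbrace{\Delta-1,\ldots,\Delta-1}_{p},\mu,\underbrace{1,\ldots,1}_{n-k-p-1}).$$
   Context: All graphs are finite, simple, connected and undirected; $d(v)$ denotes the degree of a vertex $v$. $\mathcal T_{n,k}$ is the class of trees with $n$ vertices in which exactly $k$ vertices have degree equal to the maximum vertex degree of the tree. The first multiplicative Zagreb index of a graph $G$ is $\prod_1(G)=\prod_{u\in V(G)}d(u)^2$. The degree sequence of a graph is the list of its vertex degrees in non-increasing order. -}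

module Defs where

open import Data.Fin using (Fin)
open import Data.List using (List; []; _∷_; _++_; [_]; map; filter; length; product; allFin)
open import Data.List.Extrema.Nat using (max)
open import Data.List.Relation.Unary.Linked using (Linked)
open import Data.List.Relation.Unary.Unique.Propositional using (Unique)
open import Data.Nat using (ℕ; NonZero; >-nonZero; _+_; _*_; _^_; _∸_; _/_; _≤_; _≟_)
open import Data.Nat.DivMod using (/-monoˡ-≤; m*n/n≡m)
open import Data.Nat.Properties
  using (≤-decTotalOrder; ≤-trans; ≤-reflexive; ∸-monoˡ-≤; +-monoˡ-≤; m+n∸n≡m)
open import Data.Product using (_×_)
open import Relation.Binary using (Rel; Decidable; Symmetric)
open import Relation.Binary.Construct.Closure.ReflexiveTransitive using (Star)
open import Relation.Binary.Properties.DecTotalOrder ≤-decTotalOrder using (≥-decTotalOrder)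
open import Relation.Binary.PropositionalEquality using (_≡_; sym)
open import Relation.Nullary using (¬_)
open import Level using (0ℓ)
import Data.List.Sort ≥-decTotalOrder as NonIncreasing

record SimpleGraph (n : ℕ) : Set₁ where
  infix 4 _~_ _~?_
  field
    _~_     : Rel (Fin n) 0ℓ
    _~?_    : Decidable _~_
    ~-sym   : Symmetric _~_
    ~-irrefl : ∀ {v} → ¬ (v ~ v)

module _ {n : ℕ} (G : SimpleGraph n) where
  open SimpleGraph G

  degree : Fin n → ℕ
  degree v = length (filter (v ~?_) (allFin n))

  degrees : List ℕ
  degrees = map degree (allFin n)

  degreeSequence : List ℕ
  degreeSequence = NonIncreasing.sort degrees

  maxDegree : ℕ
  maxDegree = max 0 degrees

  ∏₁ : ℕ
  ∏₁ = product (map (λ u → degree u ^ 2) (allFin n))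

  Connected : Set
  Connected = ∀ u v → Star _~_ u v

  -- The cycle v, w₁, …, wₘ, v: at least three vertices, pairwise distinct.
  IsCycle : Fin n → List (Fin n) → Set
  IsCycle v ws = 2 ≤ length ws × Unique (v ∷ ws) × Linked _~_ (v ∷ ws ++ [ v ])

  Acyclic : Set
  Acyclic = ∀ v ws → ¬ IsCycle v ws

  IsTree : Set
  IsTree = Connected × Acyclic

  -- Membership of G in the class 𝒯_{n,k}.
  InClass𝒯 : ℕ → Set
  InClass𝒯 k = IsTree × length (filter (λ v → degree v ≟ maxDegree) (allFin n)) ≡ k

-- The hypothesis is k ≤ n/2 − 1 cleared of denominators.  It gives Δ ≥ 3, so the
-- divisor Δ ∸ 2 is positive.  No subtraction below truncates:
-- k * (Δ ∸ 1) ≤ n ∸ 2 and p * (Δ ∸ 2) ≤ n ∸ 2 ∸ k * (Δ ∸ 1); hence also μ ≥ 1.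
module Parameters (n k : ℕ) .{{_ : NonZero k}} (2k+2≤n : 2 * k + 2 ≤ n) where

  Δ : ℕ
  Δ = (n ∸ 2) / k + 1

  instance
    Δ∸2-nonZero : NonZero (Δ ∸ 2)
    Δ∸2-nonZero = >-nonZero (∸-monoˡ-≤ 2 (+-monoˡ-≤ 1 2≤[n∸2]/k))
      where
      2k≤n∸2 : 2 * k ≤ n ∸ 2
      2k≤n∸2 = ≤-trans (≤-reflexive (sym (m+n∸n≡m (2 * k) 2))) (∸-monoˡ-≤ 2 2k+2≤n)

      2≤[n∸2]/k : 2 ≤ (n ∸ 2) / k
      2≤[n∸2]/k = ≤-trans (≤-reflexive (sym (m*n/n≡m 2 k))) (/-monoˡ-≤ k 2k≤n∸2)

  p : ℕ
  p = (n ∸ 2 ∸ k * (Δ ∸ 1)) / (Δ ∸ 2)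

  μ : ℕ
  μ = n ∸ 1 ∸ k * (Δ ∸ 1) ∸ p * (Δ ∸ 2)

{-# OPTIONS --safe #-}
-- Deleting leaves one at a time shows that the degrees of a tree on n vertices sum to
-- 2 (n - 1), so the excesses d - 1 sum to n - 2.  Filling the excess greedily is optimal:
-- of two factors with a fixed sum, moving them apart lowers the product, so numbers
-- between 1 and w + 1 with total excess s = q w + ρ (ρ < w) have product at least
-- F s = (w + 1)^q (ρ + 1), with equality only for the greedy list.  Here w = Δ - 2 and
-- n - 2 = k (w + 1) + r with r < k, which forces maxDegree ≤ Δ.  If maxDegree = Δ, remove the k
-- entries Δ and apply the bound to the remaining excess r.  If maxDegree < Δ, all degrees are
-- at most w + 1 and (w + 2) F s < F (s + w + 1), applied k times, makes the bound strict.
module Submission where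

open import Defs
open import Data.Fin using (Fin; zero; suc; punchIn; punchOut; toℕ)
open import Data.Fin.Properties
  using (any?; pigeonhole; punchIn-injective; punchInᵢ≢i; punchOut-cong; punchOut-punchIn; punchIn-punchOut)
  renaming (_≟_ to _≟ᶠ_)
open import Data.List
  using (List; []; _∷_; _++_; [_]; map; filter; length; lookup; replicate; allFin; tabulate)
open import Data.List.Extrema.Nat using (xs≤max)
import Data.List.Membership.DecPropositional as DecMembership
open import Data.List.Membership.Propositional.Properties using (∈-∃++; ∈-insert; ∈-lookup)
open import Data.List.Properties
  using (map-tabulate; length-map; map-++; ++-assoc; filter-some; map-replicate;
         length-++; length-replicate; length-tabulate)
open import Data.List.Relation.Binary.Permutation.Propositional
  using (_↭_; prep; swap; ↭-refl; ↭-trans; ↭-sym; ↭-reflexive; ↭⇒↭ₛ; module PermutationReasoning)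
open import Data.List.Relation.Binary.Permutation.Propositional.Properties
  using (shift; ++⁺ˡ; map⁺; drop-∷; ↭-length)
open import Data.List.Relation.Binary.Pointwise using (Pointwise-≡⇒≡)
open import Data.List.Relation.Unary.All as All using (All; []; _∷_)
import Data.List.Relation.Unary.All.Properties as All
open import Data.List.Relation.Unary.AllPairs using (AllPairs; []; _∷_)
open import Data.List.Relation.Unary.Any using (here; there)
open import Data.List.Relation.Unary.Any.Properties using (tabulate⁺)
open import Data.List.Relation.Unary.Linked using (Linked; []; [-]; _∷_)
import Data.List.Relation.Unary.Linked.Properties as Linked
open import Data.List.Relation.Unary.Sorted.TotalOrder.Properties using (↗↭↗⇒≋; AllPairs⇒Sorted)
open import Data.List.Relation.Unary.Unique.Propositional using (Unique)
import Data.List.Relation.Unary.Unique.Propositional.Properties as Unique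
open import Data.Nat
open import Data.Nat.DivMod
open import Data.Nat.ListAction using (sum; product)
open import Data.Nat.ListAction.Properties using (sum-++; sum-↭; product-++; product-↭)
open import Data.Nat.Properties
open import Data.Nat.Tactic.RingSolver using (solve-∀)
open import Data.Product using (∃; ∃₂; _×_; _,_; proj₁; proj₂)
open import Data.Sum using (_⊎_; inj₁; inj₂)
open import Function using (_∘_)
open import Function.Bundles using (_⇔_; mk⇔)
open import Level using (0ℓ)
open import Relation.Binary using (Rel; module DecTotalOrder)
open import Relation.Binary.Construct.Closure.ReflexiveTransitive using (Star; ε; _◅_; kleisliStar)
open import Relation.Binary.Properties.DecTotalOrder ≤-decTotalOrder using (≥-decTotalOrder)
open import Relation.Binary.PropositionalEquality hiding ([_])
open import Relation.Nullary using (¬_; Dec; yes; no; contradiction; ¬?; _×-dec_)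
open import Relation.Unary using (Pred; Decidable)
import Data.List.Sort ≥-decTotalOrder as NonIncreasing
open import Algebra.Properties.CommutativeMonoid.Sum +-0-commutativeMonoid
  using (sum-remove; sum-cong-≗; sum-replicate-zero; ∑-distrib-+)
  renaming (sum to ∑)

-- Degree sums in trees

module _ {A : Set} where

  AllPairs-lookup : ∀ {R : Rel A 0ℓ} {xs} → AllPairs R xs →
                    ∀ i j → toℕ i < toℕ j → R (lookup xs i) (lookup xs j)
  AllPairs-lookup {xs = _ ∷ xs} (px ∷ _) zero    (suc j) _         = All.lookup px (∈-lookup j)
  AllPairs-lookup               (_ ∷ ps) (suc i) (suc j) (s<s i<j) = AllPairs-lookup ps i j i<j

  Linked-++⁻ˡ : ∀ {R : Rel A 0ℓ} xs {ys} → Linked R (xs ++ ys) → Linked R xs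
  Linked-++⁻ˡ []           _         = []
  Linked-++⁻ˡ (_ ∷ [])     _         = [-]
  Linked-++⁻ˡ (_ ∷ x ∷ xs) (r ∷ rs)  = r ∷ Linked-++⁻ˡ (x ∷ xs) rs

  -- Closes a cycle: when the end of a path has an edge back to `y`, the cycle is `y` followed by
  -- the vertices that precede it on the path.
  Unique-rotate : ∀ xs {y : A} {zs} → Unique (xs ++ y ∷ zs) → Unique (y ∷ xs)
  Unique-rotate []       _          = [] ∷ []
  Unique-rotate (x ∷ xs) (x∉ ∷ u) with Unique-rotate xs u
  ... | y∉ ∷ u′ = ((λ y≡x → All.lookup x∉ (∈-insert xs) (sym y≡x)) ∷ y∉) ∷ (All.++⁻ˡ xs x∉ ∷ u′)

Unique⇒length≤ : ∀ {n} {xs : List (Fin n)} → Unique xs → length xs ≤ n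
Unique⇒length≤ {n} {xs} u = ≮⇒≥ λ n<l →
  let i , j , i<j , eq = pigeonhole n<l (lookup xs) in AllPairs-lookup u i j i<j eq

-- Degrees become row sums of the 0-1 adjacency matrix, so that deleting a vertex amounts to
-- removing one row and one column.
𝟙 : ∀ {P : Set} → Dec P → ℕ
𝟙 (yes _) = 1
𝟙 (no _)  = 0

𝟙-true : ∀ {P : Set} (P? : Dec P) → P → 𝟙 P? ≡ 1
𝟙-true (yes _) _ = refl
𝟙-true (no ¬p) p = contradiction p ¬p

𝟙-false : ∀ {P : Set} (P? : Dec P) → ¬ P → 𝟙 P? ≡ 0
𝟙-false (yes p) ¬p = contradiction p ¬p
𝟙-false (no _)  _  = refl

𝟙-cong : ∀ {P Q : Set} (P? : Dec P) (Q? : Dec Q) → (P → Q) → (Q → P) → 𝟙 P? ≡ 𝟙 Q?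
𝟙-cong (yes p) Q? f g = sym (𝟙-true Q? (f p))
𝟙-cong (no ¬p) Q? f g = sym (𝟙-false Q? (¬p ∘ g))

length-filter-tabulate : ∀ {n} {A : Set} {P : Pred A 0ℓ} (P? : Decidable P) (f : Fin n → A) →
                         length (filter P? (tabulate f)) ≡ ∑ (λ i → 𝟙 (P? (f i)))
length-filter-tabulate {zero}  P? f = refl
length-filter-tabulate {suc n} P? f with P? (f zero)
... | yes _ = cong suc (length-filter-tabulate P? (f ∘ suc))
... | no  _ = length-filter-tabulate P? (f ∘ suc)

sum-tabulate : ∀ {n} (f : Fin n → ℕ) → sum (tabulate f) ≡ ∑ f
sum-tabulate {zero}  f = refl
sum-tabulate {suc n} f = cong (f zero +_) (sum-tabulate (f ∘ suc))

module _ {n : ℕ} (G : SimpleGraph n) where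
  open SimpleGraph G
  open DecMembership (_≟ᶠ_ {n}) using (_∈?_)

  IsLeaf : Fin n → Fin n → Set
  IsLeaf ℓ x = ℓ ~ x × (∀ w → ℓ ~ w → w ≡ x)

  -- A path that cannot be extended beyond v ends in a leaf; an edge from v back
  -- to the path would close a cycle.
  path⇒leaf : Acyclic G → ∀ fuel v u ws → Unique (v ∷ u ∷ ws) → Linked _~_ (v ∷ u ∷ ws) →
              n < fuel + length (v ∷ u ∷ ws) → ∃₂ IsLeaf
  -- Each extension spends one unit of fuel and adds a vertex, so running out of fuel would mean
  -- more than `n` distinct vertices.
  path⇒leaf acyclic zero v u ws uniq _ n< = contradiction (Unique⇒length≤ uniq) (<⇒≱ n<)
  path⇒leaf acyclic (suc fuel) v u ws uniq path@(v~u ∷ _) n<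
    with any? (λ w → (v ~? w) ×-dec ¬? (w ≟ᶠ u))
  ... | no ∄w = v , u , v~u , only-u
    where
    only-u : ∀ w → v ~ w → w ≡ u
    only-u w v~w with w ≟ᶠ u
    ... | yes w≡u = w≡u
    ... | no  w≢u = contradiction (w , v~w , w≢u) ∄w
  ... | yes (w , v~w , w≢u) with w ∈? (v ∷ u ∷ ws)
  ...   | no w∉ = path⇒leaf acyclic fuel w v (u ∷ ws) (All.¬Any⇒All¬ _ w∉ ∷ uniq) (~-sym v~w ∷ path)
                    (subst (n <_) (sym (+-suc fuel _)) n<)
  ...   | yes (here refl)          = contradiction v~w ~-irrefl
  ...   | yes (there (here w≡u))   = contradiction w≡u w≢u
  ...   | yes (there (there w∈ws)) with ys , zs , refl ← ∈-∃++ w∈ws =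
    contradiction
      ( s≤s (s≤s z≤n)
      , Unique-rotate (v ∷ u ∷ ys) uniq
      , ~-sym v~w ∷ Linked-++⁻ˡ (v ∷ u ∷ ys ++ [ w ])
          (subst (Linked _~_) (cong (λ ts → v ∷ u ∷ ts) (sym (++-assoc ys [ w ] zs))) path))
      (acyclic w (v ∷ u ∷ ys))

  neighbour : Connected G → ∀ {u v} → u ≢ v → ∃ (u ~_)
  neighbour conn {u} {v} u≢v with conn u v
  ... | ε         = contradiction refl u≢v
  ... | u~w ◅ _   = _ , u~w

  degree≡∑ : ∀ v → degree G v ≡ ∑ (λ i → 𝟙 (v ~? i))
  degree≡∑ v = length-filter-tabulate (v ~?_) (λ i → i)

  totalDegree : ℕ
  totalDegree = ∑ (λ u → ∑ (λ v → 𝟙 (u ~? v)))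

  sum-degrees : sum (degrees G) ≡ totalDegree
  sum-degrees = trans (cong sum (map-tabulate (λ i → i) (degree G)))
                (trans (sum-tabulate (degree G)) (sum-cong-≗ degree≡∑))

exists-leaf : ∀ {n} (G : SimpleGraph (suc (suc n))) → IsTree G → ∃₂ (IsLeaf G)
exists-leaf {n} G (conn , acyclic) with neighbour G conn {zero} {suc zero} (λ ())
... | w , 0~w = path⇒leaf G acyclic (suc (suc n)) zero w []
                  (((λ { refl → ~-irrefl 0~w }) ∷ []) ∷ ([] ∷ [])) (0~w ∷ [-])
                  (m<m+n (suc (suc n)) (s≤s z≤n))
  where open SimpleGraph G

module LeafDeletion {n : ℕ} (G : SimpleGraph (suc n)) {ℓ x : Fin (suc n)} (leaf : IsLeaf G ℓ x) where
  open SimpleGraph G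
  private
    ℓ~x    = proj₁ leaf
    only-x = proj₂ leaf

  ℓ≢x : ℓ ≢ x
  ℓ≢x refl = ~-irrefl ℓ~x

  G-ℓ : SimpleGraph n
  G-ℓ = record
    { _~_      = λ u v → punchIn ℓ u ~ punchIn ℓ v
    ; _~?_     = λ u v → punchIn ℓ u ~? punchIn ℓ v
    ; ~-sym    = ~-sym
    ; ~-irrefl = ~-irrefl
    }

  acyclic : Acyclic G → Acyclic G-ℓ
  acyclic acyc v ws (2≤ , uniq , cyc) = acyc (punchIn ℓ v) (map (punchIn ℓ) ws)
    ( subst (2 ≤_) (sym (length-map (punchIn ℓ) ws)) 2≤
    , Unique.map⁺ (punchIn-injective ℓ _ _) uniq
    , subst (Linked _~_) (cong (punchIn ℓ v ∷_) (map-++ (punchIn ℓ) ws [ v ])) (Linked.map⁺ cyc))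

  -- The retraction of G onto G-ℓ sending ℓ to its neighbour x collapses the edge ℓx
  -- and preserves all the others.
  retract : Fin (suc n) → Fin n
  retract v with ℓ ≟ᶠ v
  ... | yes _  = punchOut ℓ≢x
  ... | no ℓ≢v = punchOut ℓ≢v

  retract-punchIn : ∀ v → retract (punchIn ℓ v) ≡ v
  retract-punchIn v with ℓ ≟ᶠ punchIn ℓ v
  ... | yes ℓ≡ = contradiction (sym ℓ≡) (punchInᵢ≢i ℓ v)
  ... | no  ℓ≢ = trans (punchOut-cong ℓ refl) (punchOut-punchIn ℓ)

  retract-edge : ∀ {u v} → u ~ v → Star (SimpleGraph._~_ G-ℓ) (retract u) (retract v)
  retract-edge {u} {v} u~v with ℓ ≟ᶠ u | ℓ ≟ᶠ v
  ... | yes refl | yes refl = contradiction u~v ~-irrefl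
  ... | yes refl | no ℓ≢v   = subst (Star _ _) (punchOut-cong ℓ (sym (only-x v u~v))) ε
  ... | no ℓ≢u   | yes refl = subst (Star _ _) (punchOut-cong ℓ (only-x u (~-sym u~v))) ε
  ... | no ℓ≢u   | no ℓ≢v   =
    subst₂ _~_ (sym (punchIn-punchOut ℓ≢u)) (sym (punchIn-punchOut ℓ≢v)) u~v ◅ ε

  -- The retraction carries a walk of `G` to a walk of `G-ℓ` and fixes the retained endpoints.
  connected : Connected G → Connected G-ℓ
  connected conn u v = subst₂ (Star _) (retract-punchIn u) (retract-punchIn v)
    (kleisliStar retract retract-edge (conn (punchIn ℓ u) (punchIn ℓ v)))

  leaf-degree : ∑ (λ v → 𝟙 (ℓ ~? v)) ≡ 1
  leaf-degree = begin
    ∑ (λ v → 𝟙 (ℓ ~? v))                               ≡⟨ sum-remove {i = x} (λ v → 𝟙 (ℓ ~? v)) ⟩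
    𝟙 (ℓ ~? x) + ∑ (λ v → 𝟙 (ℓ ~? punchIn x v))
      ≡⟨ cong₂ _+_ (𝟙-true (ℓ ~? x) ℓ~x)
           (sum-cong-≗ λ v → 𝟙-false (ℓ ~? punchIn x v) (punchInᵢ≢i x v ∘ only-x _)) ⟩
    1 + ∑ {n} (λ _ → 0)                                ≡⟨ cong suc (sum-replicate-zero n) ⟩
    1 ∎
    where open ≡-Reasoning

  -- By symmetry the column of `ℓ` agrees with its row, and the omitted diagonal entry is 0.
  column : ∑ (λ u → 𝟙 (punchIn ℓ u ~? ℓ)) ≡ 1
  column = begin
    ∑ (λ u → 𝟙 (punchIn ℓ u ~? ℓ))
      ≡⟨ sum-cong-≗ (λ u → 𝟙-cong (punchIn ℓ u ~? ℓ) (ℓ ~? punchIn ℓ u) ~-sym ~-sym) ⟩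
    ∑ (λ u → 𝟙 (ℓ ~? punchIn ℓ u))
      ≡⟨ cong (_+ ∑ (λ u → 𝟙 (ℓ ~? punchIn ℓ u))) (𝟙-false (ℓ ~? ℓ) ~-irrefl) ⟨
    𝟙 (ℓ ~? ℓ) + ∑ (λ u → 𝟙 (ℓ ~? punchIn ℓ u))   ≡⟨ sum-remove {i = ℓ} (λ v → 𝟙 (ℓ ~? v)) ⟨
    ∑ (λ v → 𝟙 (ℓ ~? v))                          ≡⟨ leaf-degree ⟩
    1 ∎
    where open ≡-Reasoning

  -- The edge from `ℓ` to `x` is counted once in the row of `ℓ` and once in its column; the rest of
  -- the matrix is that of `G-ℓ`.
  totalDegree-G : totalDegree G ≡ 2 + totalDegree G-ℓ
  totalDegree-G = begin
    totalDegree G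
      ≡⟨ sum-remove {i = ℓ} (λ u → ∑ (λ v → 𝟙 (u ~? v))) ⟩
    ∑ (λ v → 𝟙 (ℓ ~? v)) + ∑ (λ u → ∑ (λ v → 𝟙 (punchIn ℓ u ~? v)))
      ≡⟨ cong₂ _+_ leaf-degree (sum-cong-≗ λ u → sum-remove {i = ℓ} (λ v → 𝟙 (punchIn ℓ u ~? v))) ⟩
    1 + ∑ (λ u → 𝟙 (punchIn ℓ u ~? ℓ) + ∑ (λ v → 𝟙 (punchIn ℓ u ~? punchIn ℓ v)))
      ≡⟨ cong suc (∑-distrib-+ (λ u → 𝟙 (punchIn ℓ u ~? ℓ)) _) ⟩
    1 + (∑ (λ u → 𝟙 (punchIn ℓ u ~? ℓ)) + totalDegree G-ℓ)
      ≡⟨ cong (λ c → 1 + (c + totalDegree G-ℓ)) column ⟩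
    2 + totalDegree G-ℓ ∎
    where open ≡-Reasoning

tree-totalDegree : ∀ {n} (G : SimpleGraph (suc n)) → IsTree G → totalDegree G ≡ 2 * n
tree-totalDegree {zero} G _ = cong (λ d → d + 0 + 0) (𝟙-false (zero ~? zero) ~-irrefl)
  where open SimpleGraph G
tree-totalDegree {suc n} G tree@(conn , acyc) with exists-leaf G tree
... | ℓ , x , leaf = begin
  totalDegree G        ≡⟨ totalDegree-G ⟩
  2 + totalDegree G-ℓ  ≡⟨ cong (2 +_) (tree-totalDegree G-ℓ (connected conn , acyclic acyc)) ⟩
  2 + 2 * n            ≡⟨ *-suc 2 n ⟨
  2 * suc n            ∎
  where
  open ≡-Reasoning
  open LeafDeletion G leaf

degree-positive : ∀ {n} (G : SimpleGraph (suc (suc n))) → Connected G → ∀ v → 1 ≤ degree G v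
-- `punchIn v zero` is a vertex other than `v`, available because there are at least two vertices.
degree-positive G conn v with neighbour G conn (punchInᵢ≢i v zero ∘ sym)
... | w , v~w = filter-some (v ~?_) (tabulate⁺ {f = λ i → i} w v~w)
  where open SimpleGraph G

-- Greedy lists and minimal products

%-unique : ∀ w .{{_ : NonZero w}} {ρ} q → ρ < w → (ρ + q * w) % w ≡ ρ
%-unique w {ρ} q ρ<w = trans ([m+kn]%n≡m%n ρ q w) (m<n⇒m%n≡m ρ<w)

/-unique : ∀ w .{{_ : NonZero w}} {ρ} q → ρ < w → (ρ + q * w) / w ≡ q
/-unique w {ρ} q ρ<w = *-cancelʳ-≡ _ q w (+-cancelˡ-≡ ρ ((ρ + q * w) / w * w) (q * w) (begin
  ρ + (ρ + q * w) / w * w                ≡⟨ cong (_+ (ρ + q * w) / w * w) (%-unique w q ρ<w) ⟨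
  (ρ + q * w) % w + (ρ + q * w) / w * w  ≡⟨ m≡m%n+[m/n]*n (ρ + q * w) w ⟨
  ρ + q * w                              ∎))
  where open ≡-Reasoning

+-reverse : ∀ a b c → a + b + c ≡ c + b + a
+-reverse = solve-∀

+-swapˡ : ∀ a b c → a + b + c ≡ b + (a + c)
+-swapˡ = solve-∀

-- Used where a product exceeds its bound by an explicit term `a * (b * c)`: equality makes this
-- term vanish.
no-gap : ∀ m a b {c} .{{_ : NonZero a}} → m + a * (b * c) ≡ m → b ≡ 0 ⊎ c ≡ 0
no-gap m a b {c} eq = m*n≡0⇒m≡0∨n≡0 b (m*n≡0⇒m≡0 (b * c) a
  (trans (*-comm (b * c) a) (+-cancelˡ-≡ m _ 0 (trans eq (sym (+-identityʳ m))))))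

-- Two factors with a fixed sum are moved apart until one of them is suc w.
spread : ∀ a {x ρ w y h k} → x + h ≡ w → ρ + k ≡ w → w + y ≡ x + ρ →
         suc x * (a * suc ρ) ≡ suc w * a * suc y + a * (h * k)
spread a {x} {ρ} {w} {y} {h} {k} refl ρ+k≡x+h x+h+y≡x+ρ
  -- The constraints give `ρ = h + y` and `x = k + y`; in the free variables `a`, `h`, `k`, `y` the
  -- claim is a polynomial identity.
  with refl ← +-cancelˡ-≡ x (h + y) ρ (trans (sym (+-assoc x h y)) x+h+y≡x+ρ)
  with refl ← +-cancelʳ-≡ h (k + y) x (trans (+-reverse k y h) ρ+k≡x+h)
  = identity a h k y
  where
  identity : ∀ a h k y → suc (k + y) * (a * suc (h + y)) ≡ suc (k + y + h) * a * suc y + a * (h * k)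
  identity = solve-∀

module Greedy (w : ℕ) .{{_ : NonZero w}} where

  0<w : 0 < w
  0<w = >-nonZero⁻¹ w

  -- The least product of numbers between 1 and suc w whose total excess over 1 is s.
  F : ℕ → ℕ
  F s = suc w ^ (s / w) * suc (s % w)

  -- The remainder entry is listed even when it is 1, just as `μ` has its own place in the target
  -- sequence; `j` counts the further ones.
  greedy : ℕ → ℕ → List ℕ
  greedy s j = replicate (s / w) (suc w) ++ suc (s % w) ∷ replicate j 1

  -- The boundary case `ρ = w` is included: a full remainder contributes the same factor `suc w` as
  -- one more unit of quotient.
  F-eval : ∀ {ρ} q → ρ ≤ w → F (ρ + q * w) ≡ suc w ^ q * suc ρ
  F-eval {ρ} q ρ≤w with m≤n⇒m<n∨m≡n ρ≤w
  ... | inj₁ ρ<w  = cong₂ (λ a b → suc w ^ a * suc b) (/-unique w q ρ<w) (%-unique w q ρ<w)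
  ... | inj₂ refl = begin
    F (suc q * w)
      ≡⟨ cong₂ (λ a b → suc w ^ a * suc b) (/-unique w (suc q) 0<w) (%-unique w (suc q) 0<w) ⟩
    suc w ^ suc q * 1  ≡⟨ *-identityʳ _ ⟩
    suc w * suc w ^ q  ≡⟨ *-comm (suc w) _ ⟩
    suc w ^ q * suc w  ∎
    where open ≡-Reasoning

  greedy-eval : ∀ {ρ} q j → ρ < w → greedy (ρ + q * w) j ≡ replicate q (suc w) ++ suc ρ ∷ replicate j 1
  greedy-eval q j ρ<w =
    cong₂ (λ a b → replicate a (suc w) ++ suc b ∷ replicate j 1) (/-unique w q ρ<w) (%-unique w q ρ<w)

  +-division : ∀ x s → x + s ≡ x + s % w + s / w * w
  +-division x s = trans (cong (x +_) (m≡m%n+[m/n]*n s w)) (sym (+-assoc x _ _))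

  -- The new factor `suc x` interacts only with the remainder factor `suc ρ`. If `x + ρ` fits into
  -- `w`, merging them into one factor lowers the product by `a * (x * ρ)`; otherwise spreading them
  -- to `suc w` and `suc y` lowers it by `a * (h * k)`. Equality means that the loss is zero.
  F-step : ∀ {x} s → x ≤ w →
           F (x + s) ≤ suc x * F s × (F (x + s) ≡ suc x * F s → x ≡ 0 ⊎ x ≡ w ⊎ s % w ≡ 0)
  F-step {x} s x≤w with x + s % w ≤? w
  ... | yes x+ρ≤w = m+n≤o⇒m≤o (F (x + s)) (≤-reflexive gap) , equality
    where
    a = suc w ^ (s / w)
    ρ = s % w
    identity : ∀ a x ρ → suc x * (a * suc ρ) ≡ a * suc (x + ρ) + a * (x * ρ)
    identity = solve-∀
    gap : F (x + s) + a * (x * ρ) ≡ suc x * F s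
    gap = trans (cong (_+ a * (x * ρ)) (trans (cong F (+-division x s)) (F-eval (s / w) x+ρ≤w)))
                   (sym (identity a x ρ))
    equality : F (x + s) ≡ suc x * F s → x ≡ 0 ⊎ x ≡ w ⊎ ρ ≡ 0
    equality eq with no-gap (F (x + s)) a x {{m^n≢0 (suc w) (s / w)}} (trans gap (sym eq))
    ... | inj₁ x≡0 = inj₁ x≡0
    ... | inj₂ ρ≡0 = inj₂ (inj₂ ρ≡0)
  -- The witnesses `h` and `k` are the room left by `x` and by the remainder below `w`, and `y` is
  -- the overflow of their sum beyond `w`.
  ... | no x+ρ≰w with m≤n⇒∃[o]m+o≡n x≤w
                    | m≤n⇒∃[o]m+o≡n (<⇒≤ (m%n<n s w))
                    | m≤n⇒∃[o]m+o≡n (<⇒≤ (≰⇒> x+ρ≰w))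
  ... | h , x+h≡w | k , ρ+k≡w | y , w+y≡x+ρ = m+n≤o⇒m≤o (F (x + s)) (≤-reflexive gap) , equality
    where
    a = suc w ^ (s / w)
    ρ = s % w
    y≤w : y ≤ w
    y≤w = +-cancelˡ-≤ w y w (≤-trans (≤-reflexive w+y≡x+ρ) (+-mono-≤ x≤w (<⇒≤ (m%n<n s w))))
    x+s≡ : x + s ≡ y + suc (s / w) * w
    x+s≡ = trans (+-division x s) (trans (cong (_+ s / w * w) (sym w+y≡x+ρ)) (+-swapˡ w y (s / w * w)))
    gap : F (x + s) + a * (h * k) ≡ suc x * F s
    gap = trans (cong (_+ a * (h * k)) (trans (cong F x+s≡) (F-eval (suc (s / w)) y≤w)))
                   (sym (spread a x+h≡w ρ+k≡w w+y≡x+ρ))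
    equality : F (x + s) ≡ suc x * F s → x ≡ 0 ⊎ x ≡ w ⊎ ρ ≡ 0
    equality eq with no-gap (F (x + s)) a h {{m^n≢0 (suc w) (s / w)}} (trans gap (sym eq))
    ... | inj₁ refl = inj₂ (inj₁ (trans (sym (+-identityʳ x)) x+h≡w))
    -- The remainder is strictly below `w`, so its room `k` cannot be 0.
    ... | inj₂ refl = contradiction (trans (sym (+-identityʳ ρ)) ρ+k≡w) (<⇒≢ (m%n<n s w))

  -- Trading the oversized factor `suc (suc w)` for `suc w` and one more unit in the remainder
  -- factor moves the two closer together. The product grows by `a * suc k`, where `suc k` is the
  -- room `w - ρ` left by the remainder.
  F-gain : ∀ s → suc (suc w) * F s < F (suc w + s)
  F-gain s with m≤n⇒∃[o]m+o≡n (m%n<n s w)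
  ... | k , 1+ρ+k≡w = begin-strict
    suc (suc w) * F s                      <⟨ m<m+n _ a*1+k>0 ⟩
    suc (suc w) * (a * suc ρ) + a * suc k  ≡⟨ identity′ ⟨
    suc w * a * suc (suc ρ)                ≡⟨ F-eval (suc (s / w)) (m%n<n s w) ⟨
    F (suc ρ + suc (s / w) * w)            ≡⟨ cong F (shuffle ρ w (s / w * w)) ⟩
    F (suc w + (ρ + s / w * w))            ≡⟨ cong (λ t → F (suc w + t)) (m≡m%n+[m/n]*n s w) ⟨
    F (suc w + s)                          ∎
    where
    open ≤-Reasoning
    a = suc w ^ (s / w)
    ρ = s % w
    a*1+k>0 : 0 < a * suc k
    a*1+k>0 = *-mono-≤ (m^n>0 (suc w) (s / w)) (s≤s {n = k} z≤n)
    shuffle : ∀ ρ w b → suc ρ + (w + b) ≡ suc w + (ρ + b)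
    shuffle = solve-∀
    identity : ∀ a ρ k → suc (suc ρ + k) * a * suc (suc ρ) ≡ suc (suc (suc ρ + k)) * (a * suc ρ) + a * suc k
    identity = solve-∀
    identity′ : suc w * a * suc (suc ρ) ≡ suc (suc w) * (a * suc ρ) + a * suc k
    identity′ = subst (λ v → suc v * a * suc (suc ρ) ≡ suc (suc v) * (a * suc ρ) + a * suc k)
                      1+ρ+k≡w (identity a ρ k)

  -- The induction starts at `k = 1`, since at `k = 0` both sides agree.
  F-gain^ : ∀ k s .{{_ : NonZero k}} → suc (suc w) ^ k * F s < F (k * suc w + s)
  F-gain^ 1 s = subst₂ _<_ (cong (_* F s) (sym (*-identityʳ (suc (suc w)))))
                           (cong (λ t → F (t + s)) (sym (*-identityˡ (suc w)))) (F-gain s)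
  F-gain^ (suc k@(suc _)) s = begin-strict
    suc (suc w) * suc (suc w) ^ k * F s    ≡⟨ *-assoc (suc (suc w)) (suc (suc w) ^ k) (F s) ⟩
    suc (suc w) * (suc (suc w) ^ k * F s)  <⟨ *-monoʳ-< (suc (suc w)) (F-gain^ k s) ⟩
    suc (suc w) * F (k * suc w + s)        <⟨ F-gain (k * suc w + s) ⟩
    F (suc w + (k * suc w + s))            ≡⟨ cong F (+-assoc (suc w) _ s) ⟨
    F (suc k * suc w + s)                  ∎
    where open ≤-Reasoning

  greedy-suc : ∀ s j → greedy s (suc j) ↭ 1 ∷ greedy s j
  greedy-suc s j = ↭-trans (++⁺ˡ (replicate (s / w) (suc w)) (swap (suc (s % w)) 1 ↭-refl))
                           (shift 1 (replicate (s / w) (suc w)) _)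

  greedy-full : ∀ s j → greedy (w + s) j ≡ suc w ∷ greedy s j
  greedy-full s j = trans
    (cong (λ t → greedy t j) (trans (+-division w s) (+-swapˡ w (s % w) (s / w * w))))
    (greedy-eval (suc (s / w)) j (m%n<n s w))

  -- In the equality cases of `F-step` the list stays greedy: an entry 1 joins the ones, an entry
  -- `suc w` joins the full entries, and when the remainder entry is 1 the new entry takes its place
  -- while that 1 joins the ones.
  greedy-step : ∀ {x} s j → x ≤ w → x ≡ 0 ⊎ x ≡ w ⊎ s % w ≡ 0 →
                ∃ λ j′ → suc x ∷ greedy s j ↭ greedy (x + s) j′
  greedy-step s j _ (inj₁ refl) = suc j , ↭-sym (greedy-suc s j)
  greedy-step s j _ (inj₂ (inj₁ refl)) = j , ↭-reflexive (sym (greedy-full s j))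
  greedy-step {x} s j x≤w (inj₂ (inj₂ ρ≡0)) with m≤n⇒m<n∨m≡n x≤w
  ... | inj₂ refl = j , ↭-reflexive (sym (greedy-full s j))
  ... | inj₁ x<w = suc j , (begin
    suc x ∷ replicate (s / w) (suc w) ++ suc (s % w) ∷ replicate j 1  ↭⟨ shift (suc x) (replicate (s / w) (suc w)) _ ⟨
    replicate (s / w) (suc w) ++ suc x ∷ suc (s % w) ∷ replicate j 1
      ≡⟨ cong (λ t → replicate (s / w) (suc w) ++ suc x ∷ suc t ∷ replicate j 1) ρ≡0 ⟩
    replicate (s / w) (suc w) ++ suc x ∷ replicate (suc j) 1          ≡⟨ greedy-eval (s / w) (suc j) x<w ⟨
    greedy (x + s / w * w) (suc j)
      ≡⟨ cong (λ t → greedy t (suc j)) (trans (+-division x s)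
           (cong (_+ s / w * w) (trans (cong (x +_) ρ≡0) (+-identityʳ x)))) ⟨
    greedy (x + s) (suc j)                                            ∎)
    where open PermutationReasoning

  Bounded : ℕ → Set
  Bounded e = 1 ≤ e × e ≤ suc w

  excess : List ℕ → ℕ
  excess es = sum (map pred es)

  F≤product : ∀ {es} → All Bounded es → F (excess es) ≤ product es
  F≤product [] = ≤-reflexive (F-eval 0 z≤n)
  F≤product {suc x ∷ es} ((_ , s≤s x≤w) ∷ bs) =
    ≤-trans (proj₁ (F-step (excess es) x≤w)) (*-monoʳ-≤ (suc x) (F≤product bs))

  -- The extra 1 leaves room for the entry suc (s % w) of the greedy list when s % w is 0.
  product≡F⇒greedy : ∀ {es} → All Bounded es → product es ≡ F (excess es) →
                     ∃ λ j → 1 ∷ es ↭ greedy (excess es) j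
  product≡F⇒greedy [] _ = 0 , ↭-reflexive (sym (greedy-eval 0 0 0<w))
  product≡F⇒greedy {suc x ∷ es} ((_ , s≤s x≤w) ∷ bs) eq =
    let j  , es↭   = product≡F⇒greedy bs tail-tight
        j′ , step↭ = greedy-step (excess es) j x≤w (proj₂ (F-step (excess es) x≤w) head-tight)
    in  j′ , ↭-trans (swap 1 (suc x) ↭-refl) (↭-trans (prep (suc x) es↭) step↭)
    where
    s = excess es
    -- Equality of the two ends of `F (x + s) ≤ suc x * F s ≤ suc x * product es` forces equality at
    -- each link.
    head-tight : F (x + s) ≡ suc x * F s
    head-tight = ≤-antisym (proj₁ (F-step s x≤w))
      (≤-trans (*-monoʳ-≤ (suc x) (F≤product bs)) (≤-reflexive eq))
    tail-tight : product es ≡ F s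
    tail-tight = *-cancelˡ-≡ _ _ (suc x) (trans eq head-tight)

-- Lists whose maximum occurs a prescribed number of times

filter-≡-↭ : ∀ {D : ℕ} (≟D : Decidable (_≡ D)) xs →
             xs ↭ replicate (length (filter ≟D xs)) D ++ filter (λ x → ¬? (≟D x)) xs
filter-≡-↭ ≟D []       = ↭-refl
filter-≡-↭ {D} ≟D (x ∷ xs) with ≟D x
... | yes refl = prep x (filter-≡-↭ ≟D xs)
... | no  _    = ↭-trans (prep x (filter-≡-↭ ≟D xs)) (↭-sym (shift x (replicate (length (filter ≟D xs)) D) _))

sum-replicate : ∀ k x → sum (replicate k x) ≡ k * x
sum-replicate zero    x = refl
sum-replicate (suc k) x = cong (x +_) (sum-replicate k x)

product-replicate : ∀ k x → product (replicate k x) ≡ x ^ k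
product-replicate zero    x = refl
product-replicate (suc k) x = cong (x *_) (product-replicate k x)

module _ (w k r : ℕ) .{{_ : NonZero w}} .{{_ : NonZero k}} (r<k : r < k) where
  open Greedy w

  -- The maximum `D` is not fixed in advance: the total excess caps it at `suc (suc w)`, and any
  -- smaller value makes the bound strict, so equality also determines `D`.
  minimal-product : ∀ D xs → All (1 ≤_) xs → All (_≤ D) xs → length (filter (_≟ D) xs) ≡ k →
    excess xs ≡ k * suc w + r →
    suc (suc w) ^ k * F r ≤ product xs ×
    (product xs ≡ suc (suc w) ^ k * F r → ∃ λ j → 1 ∷ xs ↭ replicate k (suc (suc w)) ++ greedy r j)
  minimal-product D xs 1≤xs xs≤D count total = by-cases (m≤n⇒m<n∨m≡n D≤2+w)
    where
    es = filter (λ x → ¬? (x ≟ D)) xs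

    xs↭ : xs ↭ replicate k D ++ es
    xs↭ = subst (λ c → xs ↭ replicate c D ++ es) count (filter-≡-↭ (_≟ D) xs)

    excess-split : excess xs ≡ k * pred D + excess es
    excess-split = begin
      excess xs                                            ≡⟨ sum-↭ (map⁺ pred xs↭) ⟩
      sum (map pred (replicate k D ++ es))                 ≡⟨ cong sum (map-++ pred (replicate k D) es) ⟩
      sum (map pred (replicate k D) ++ map pred es)        ≡⟨ sum-++ (map pred (replicate k D)) _ ⟩
      sum (map pred (replicate k D)) + excess es
        ≡⟨ cong (λ l → sum l + excess es) (map-replicate pred k D) ⟩
      sum (replicate k (pred D)) + excess es               ≡⟨ cong (_+ excess es) (sum-replicate k (pred D)) ⟩
      k * pred D + excess es                               ∎
      where open ≡-Reasoning

    -- The `k` entries `D` alone have excess `k * pred D`, which is at most the total and hence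
    -- below `k * suc (suc w)`.
    D≤2+w : D ≤ suc (suc w)
    D≤2+w = pred-≤⇒≤-suc (≤-pred (*-cancelˡ-< k _ _ (begin-strict
      k * pred D              ≤⟨ m≤m+n _ (excess es) ⟩
      k * pred D + excess es  ≡⟨ trans (sym excess-split) total ⟩
      k * suc w + r           <⟨ +-monoʳ-< (k * suc w) r<k ⟩
      k * suc w + k           ≡⟨ trans (+-comm (k * suc w) k) (sym (*-suc k (suc w))) ⟩
      k * suc (suc w)         ∎)))
      where
      open ≤-Reasoning
      pred-≤⇒≤-suc : ∀ {m n} → pred m ≤ n → m ≤ suc n
      pred-≤⇒≤-suc {zero}  _ = z≤n
      pred-≤⇒≤-suc {suc m} p = s≤s p

    by-cases : D < suc (suc w) ⊎ D ≡ suc (suc w) →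
      suc (suc w) ^ k * F r ≤ product xs ×
      (product xs ≡ suc (suc w) ^ k * F r → ∃ λ j → 1 ∷ xs ↭ replicate k (suc (suc w)) ++ greedy r j)
    by-cases (inj₁ (s≤s D≤1+w)) = <⇒≤ strict , λ eq → contradiction (sym eq) (<⇒≢ strict)
      where
      strict : suc (suc w) ^ k * F r < product xs
      strict = <-≤-trans (F-gain^ k r) (≤-trans (≤-reflexive (cong F (sym total)))
        (F≤product (All.zip (1≤xs , All.map (λ x≤D → ≤-trans x≤D D≤1+w) xs≤D))))
    by-cases (inj₂ refl) = bound , equality
      where
      bounded : All Bounded es
      bounded = All.zip
        ( All.filter⁺ (λ x → ¬? (x ≟ D)) 1≤xs
        , All.zipWith (λ (x≤D , x≢D) → ≤-pred (≤∧≢⇒< x≤D x≢D))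
            (All.filter⁺ (λ x → ¬? (x ≟ D)) xs≤D , All.all-filter (λ x → ¬? (x ≟ D)) xs))

      excess-es : excess es ≡ r
      excess-es = +-cancelˡ-≡ (k * suc w) _ _ (trans (sym excess-split) total)

      product-split : product xs ≡ D ^ k * product es
      product-split = trans (product-↭ xs↭)
        (trans (product-++ (replicate k D) es) (cong (_* product es) (product-replicate k D)))

      bound : D ^ k * F r ≤ product xs
      bound = ≤-trans (*-monoʳ-≤ (D ^ k) (≤-trans (≤-reflexive (cong F (sym excess-es))) (F≤product bounded)))
                      (≤-reflexive (sym product-split))

      equality : product xs ≡ D ^ k * F r → ∃ λ j → 1 ∷ xs ↭ replicate k D ++ greedy r j
      equality eq with product≡F⇒greedy bounded (trans
        (*-cancelˡ-≡ _ _ (D ^ k) {{m^n≢0 D k}} (trans (sym product-split) eq)) (cong F (sym excess-es)))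
      ... | j , es↭ = j , (begin
        1 ∷ xs                             ↭⟨ prep 1 xs↭ ⟩
        1 ∷ replicate k D ++ es            ↭⟨ shift 1 (replicate k D) es ⟨
        replicate k D ++ 1 ∷ es            ↭⟨ ++⁺ˡ (replicate k D) es↭ ⟩
        replicate k D ++ greedy (excess es) j  ≡⟨ cong (λ s → replicate k D ++ greedy s j) excess-es ⟩
        replicate k D ++ greedy r j        ∎)
        where open PermutationReasoning

-- Degree sequences

length-filter-map : ∀ {A B : Set} {P : Pred B 0ℓ} (P? : Decidable P) (f : A → B) xs →
                    length (filter P? (map f xs)) ≡ length (filter (λ x → P? (f x)) xs)
length-filter-map P? f []       = refl
length-filter-map P? f (x ∷ xs) with P? (f x)
... | yes _ = cong suc (length-filter-map P? f xs)
... | no  _ = length-filter-map P? f xs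

sum-pred : ∀ {xs} → All (1 ≤_) xs → sum (map pred xs) + length xs ≡ sum xs
sum-pred []                             = refl
sum-pred {suc x ∷ xs} (_ ∷ 1≤xs) = trans (rearrange x (sum (map pred xs)) (length xs)) (cong (suc x +_) (sum-pred 1≤xs))
  where
  rearrange : ∀ a b c → a + b + suc c ≡ suc a + (b + c)
  rearrange = solve-∀

square-* : ∀ a b → a ^ 2 * b ^ 2 ≡ (a * b) ^ 2
square-* = unfolded
  where
  unfolded : ∀ a b → a * (a * 1) * (b * (b * 1)) ≡ a * b * (a * b * 1)
  unfolded = solve-∀

product-map-square : ∀ {A : Set} (f : A → ℕ) xs → product (map (λ x → f x ^ 2) xs) ≡ product (map f xs) ^ 2
product-map-square f []       = refl
product-map-square f (x ∷ xs) =
  trans (cong (f x ^ 2 *_) (product-map-square f xs)) (square-* (f x) (product (map f xs)))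

^2-injective : ∀ {a b} → a ^ 2 ≡ b ^ 2 → a ≡ b
^2-injective {a} {b} eq = ≤-antisym (≮⇒≥ (<⇒≢′ (sym eq))) (≮⇒≥ (<⇒≢′ eq))
  where
  <⇒≢′ : ∀ {a b} → a ^ 2 ≡ b ^ 2 → ¬ a < b
  <⇒≢′ eq a<b = <⇒≢ (^-monoˡ-< 2 a<b) eq

replicate-++-nonIncreasing : ∀ m {x ys} → All (x ≥_) ys → AllPairs _≥_ ys → AllPairs _≥_ (replicate m x ++ ys)
replicate-++-nonIncreasing zero    x≥ys ys↘ = ys↘
replicate-++-nonIncreasing (suc m) x≥ys ys↘ =
  All.++⁺ (All.replicate⁺ m ≤-refl) x≥ys ∷ replicate-++-nonIncreasing m x≥ys ys↘

-- A list has only one non-increasing rearrangement, so it suffices to know the degrees up to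
-- permutation.
sort-unique : ∀ {xs ys} → AllPairs _≥_ ys → xs ↭ ys → NonIncreasing.sort xs ≡ ys
sort-unique {xs} ys↘ xs↭ys = Pointwise-≡⇒≡ (↗↭↗⇒≋ ≥-totalOrder
  (NonIncreasing.sort-↗ xs) (AllPairs⇒Sorted ≥-totalOrder ys↘)
  (↭⇒↭ₛ (↭-trans (NonIncreasing.sort-↭ xs) xs↭ys)))
  where ≥-totalOrder = DecTotalOrder.totalOrder ≥-decTotalOrder

module _ (w k r : ℕ) .{{_ : NonZero w}} where
  open Greedy w

  -- The number `j` of trailing ones stays free until `drop-one` recovers it from the length.
  extremal : ℕ → List ℕ
  extremal j = replicate k (suc (suc w)) ++ greedy r j

  extremal-nonIncreasing : ∀ j → AllPairs _≥_ (extremal j)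
  extremal-nonIncreasing j =
    replicate-++-nonIncreasing k
      (All.++⁺ (All.replicate⁺ (r / w) (n≤1+n _)) (m≤n⇒m≤1+n (s≤s ρ≤w) ∷ All.replicate⁺ j (s≤s z≤n)))
      (replicate-++-nonIncreasing (r / w) (s≤s ρ≤w ∷ All.replicate⁺ j (s≤s z≤n))
        (All.replicate⁺ j (s≤s z≤n) ∷ ones j))
    where
    ρ≤w : r % w ≤ w
    ρ≤w = <⇒≤ (m%n<n r w)
    ones : ∀ j → AllPairs _≥_ (replicate j 1)
    ones zero    = []
    ones (suc j) = All.replicate⁺ j ≤-refl ∷ ones j

  extremal-suc : ∀ j → extremal (suc j) ↭ 1 ∷ extremal j
  extremal-suc j = ↭-trans (++⁺ˡ (replicate k (suc (suc w))) (greedy-suc r j))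
                           (shift 1 (replicate k (suc (suc w))) (greedy r j))

  length-extremal : ∀ j → length (extremal j) ≡ suc (k + r / w + j)
  length-extremal j = begin
    length (extremal j)
      ≡⟨ length-++ (replicate k (suc (suc w))) ⟩
    length (replicate k (suc (suc w))) + length (greedy r j)
      ≡⟨ cong₂ _+_ (length-replicate k) (length-++ (replicate (r / w) (suc w))) ⟩
    k + (length (replicate (r / w) (suc w)) + suc (length (replicate j 1)))
      ≡⟨ cong₂ (λ a b → k + (a + suc b)) (length-replicate (r / w)) (length-replicate j) ⟩
    k + (r / w + suc j)
      ≡⟨ shuffle k (r / w) j ⟩
    suc (k + r / w + j) ∎
    where
    open ≡-Reasoning
    shuffle : ∀ a b c → a + (b + suc c) ≡ suc (a + b + c)
    shuffle = solve-∀

  product-extremal : ∀ j → product (extremal j) ≡ suc (suc w) ^ k * F r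
  product-extremal j = begin
    product (extremal j)
      ≡⟨ product-++ (replicate k (suc (suc w))) (greedy r j) ⟩
    product (replicate k (suc (suc w))) * product (greedy r j)
      ≡⟨ cong₂ _*_ (product-replicate k (suc (suc w))) (product-++ (replicate (r / w) (suc w)) _) ⟩
    suc (suc w) ^ k * (product (replicate (r / w) (suc w)) * (suc (r % w) * product (replicate j 1)))
      ≡⟨ cong (suc (suc w) ^ k *_) (cong₂ _*_ (product-replicate (r / w) (suc w))
           (trans (cong (suc (r % w) *_) (trans (product-replicate j 1) (^-zeroˡ j))) (*-identityʳ (suc (r % w))))) ⟩
    suc (suc w) ^ k * F r ∎
    where open ≡-Reasoning

  -- Comparing lengths gives `length xs = k + r / w + j`. As `r / w ≤ r`, the hypothesis makes `j`
  -- positive, so one trailing 1 cancels against the auxiliary 1 in front of `xs`.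
  drop-one : ∀ {xs j} → k + r < length xs → 1 ∷ xs ↭ extremal j → xs ↭ extremal (length xs ∸ k ∸ r / w ∸ 1)
  drop-one {xs} {j} k+r<len 1∷xs↭ = from-length j 1∷xs↭ (suc-injective (trans (↭-length 1∷xs↭) (length-extremal j)))
    where
    k+p<len : k + r / w < length xs
    k+p<len = ≤-<-trans (+-monoʳ-≤ k (m/n≤m r w)) k+r<len

    from-length : ∀ j → 1 ∷ xs ↭ extremal j → length xs ≡ k + r / w + j → xs ↭ extremal (length xs ∸ k ∸ r / w ∸ 1)
    from-length zero    _   len≡ = contradiction (sym (trans len≡ (+-identityʳ _))) (<⇒≢ k+p<len)
    from-length (suc j) 1∷xs↭ len≡ = subst (λ i → xs ↭ extremal i) (sym j≡)
      (drop-∷ (↭-trans 1∷xs↭ (extremal-suc j)))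
      where
      j≡ : length xs ∸ k ∸ r / w ∸ 1 ≡ j
      j≡ = cong (_∸ 1) (trans (∸-+-assoc (length xs) k (r / w))
             (trans (cong (_∸ (k + r / w)) len≡) (m+n∸m≡n (k + r / w) (suc j))))

-- Degrees of a tree and arithmetic of the parameters

module TreeDegrees {n : ℕ} (T : SimpleGraph (suc (suc n))) (tree : IsTree T) where

  degrees-positive : All (1 ≤_) (degrees T)
  degrees-positive = All.map⁺ (All.universal (degree-positive T (proj₁ tree)) (allFin (suc (suc n))))

  length-degrees : length (degrees T) ≡ suc (suc n)
  length-degrees = trans (length-map (degree T) (allFin (suc (suc n)))) (length-tabulate (λ i → i))

  excess-degrees : sum (map pred (degrees T)) ≡ n
  excess-degrees = +-cancelʳ-≡ (suc (suc n)) _ n (begin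
    sum (map pred (degrees T)) + suc (suc n)         ≡⟨ cong (sum (map pred (degrees T)) +_) length-degrees ⟨
    sum (map pred (degrees T)) + length (degrees T)  ≡⟨ sum-pred degrees-positive ⟩
    sum (degrees T)                                  ≡⟨ trans (sum-degrees T) (tree-totalDegree T tree) ⟩
    2 * suc n                                        ≡⟨ identity n ⟩
    n + suc (suc n)                                  ∎)
    where
    open ≡-Reasoning
    identity : ∀ n → 2 * suc n ≡ n + suc (suc n)
    identity = solve-∀

square-bound : ∀ a b c k p → a ^ (2 * k) * b ^ (2 * p) * c ^ 2 ≡ (a ^ k * (b ^ p * c)) ^ 2
square-bound a b c k p = trans
  (cong₂ (λ x y → x * y * c ^ 2) (double a k) (double b p))
  (trans (cong (_* c ^ 2) (square-* (a ^ k) (b ^ p)))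
  (trans (square-* (a ^ k * b ^ p) c)
         (cong (_^ 2) (*-assoc (a ^ k) (b ^ p) c))))
  where
  double : ∀ a k → a ^ (2 * k) ≡ (a ^ k) ^ 2
  double a k = trans (cong (a ^_) (*-comm 2 k)) (sym (^-*-assoc a k 2))

module ParameterIdentities (m k : ℕ) .{{_ : NonZero k}} (2k+2≤n : 2 * k + 2 ≤ suc (suc m)) where
  open Parameters (suc (suc m)) k 2k+2≤n

  -- `r` is the remainder of `m` modulo `k`; by definition `p` is `r / w`.
  w r : ℕ
  w = Δ ∸ 2
  r = m ∸ k * (Δ ∸ 1)

  Δ≡2+w : Δ ≡ suc (suc w)
  Δ≡2+w = sym (m+[n∸m]≡n (<⇒≤ (m∸n≢0⇒n<m {Δ} {2} (≢-nonZero⁻¹ (Δ ∸ 2)))))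

  Δ∸1≡1+w : Δ ∸ 1 ≡ suc w
  Δ∸1≡1+w = cong (_∸ 1) Δ≡2+w

  k*[Δ∸1]≡ : k * (Δ ∸ 1) ≡ m / k * k
  k*[Δ∸1]≡ = trans (cong (k *_) (m+n∸n≡m (m / k) 1)) (*-comm k (m / k))

  k*[Δ∸1]≤m : k * (Δ ∸ 1) ≤ m
  k*[Δ∸1]≤m = ≤-trans (≤-reflexive k*[Δ∸1]≡) (m/n*n≤m m k)

  r<k : r < k
  r<k = subst (_< k) (trans (m%n≡m∸m/n*n m k) (cong (m ∸_) (sym k*[Δ∸1]≡))) (m%n<n m k)

  m≡k*[1+w]+r : m ≡ k * suc w + r
  m≡k*[1+w]+r = trans (sym (m+[n∸m]≡n k*[Δ∸1]≤m)) (cong (λ d → k * d + r) Δ∸1≡1+w)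

  -- Neither subtraction truncates, so the 1 in `suc m` can be pulled out, leaving the remainder of
  -- `r` modulo `w`.
  μ≡ : μ ≡ suc (r % w)
  μ≡ = begin
    suc m ∸ k * (Δ ∸ 1) ∸ r / w * w  ≡⟨ cong (_∸ r / w * w) (+-∸-assoc 1 k*[Δ∸1]≤m) ⟩
    suc r ∸ r / w * w                ≡⟨ +-∸-assoc 1 (m/n*n≤m r w) ⟩
    suc (r ∸ r / w * w)              ≡⟨ cong suc (m%n≡m∸m/n*n r w) ⟨
    suc (r % w)                      ∎
    where open ≡-Reasoning

  open Greedy w using (F)

  bound≡ : Δ ^ (2 * k) * (Δ ∸ 1) ^ (2 * p) * μ ^ 2 ≡ (suc (suc w) ^ k * F r) ^ 2
  bound≡ = trans (square-bound Δ (Δ ∸ 1) μ k p)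
    (trans (cong (λ d → (Δ ^ k * (d ^ p * μ)) ^ 2) Δ∸1≡1+w)
           (cong₂ (λ d e → (d ^ k * (suc w ^ p * e)) ^ 2) Δ≡2+w μ≡))

  sequence≡ : ∀ j → replicate k Δ ++ replicate p (Δ ∸ 1) ++ μ ∷ replicate j 1 ≡ extremal w k r j
  sequence≡ j =
    trans (cong (λ d → replicate k Δ ++ replicate p d ++ μ ∷ replicate j 1) Δ∸1≡1+w)
          (cong₂ (λ d e → replicate k d ++ replicate p (suc w) ++ e ∷ replicate j 1) Δ≡2+w μ≡)

  -- Provides the spare 1 that `drop-one` cancels.
  k+r<n : k + r < suc (suc m)
  k+r<n = begin-strict
    k + r      ≤⟨ +-monoʳ-≤ k (<⇒≤ r<k) ⟩
    k + k      ≡⟨ cong (k +_) (+-identityʳ k) ⟨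
    2 * k      <⟨ m<m+n (2 * k) (s≤s z≤n) ⟩
    2 * k + 2  ≤⟨ 2k+2≤n ⟩
    suc (suc m) ∎
    where open ≤-Reasoning

theorem3p1 : (n k : ℕ) .{{_ : NonZero k}} (2k+2≤n : 2 * k + 2 ≤ n)
    (T : SimpleGraph n) → InClass𝒯 T k →
    let open Parameters n k 2k+2≤n
        bound = Δ ^ (2 * k) * (Δ ∸ 1) ^ (2 * p) * μ ^ 2
    in  bound ≤ ∏₁ T
        × (∏₁ T ≡ bound ⇔
           degreeSequence T ≡ replicate k Δ ++ replicate p (Δ ∸ 1) ++ μ ∷ replicate (n ∸ k ∸ p ∸ 1) 1)
theorem3p1 0 k 2k+2≤0 = contradiction (m+n≤o⇒n≤o (2 * k) 2k+2≤0) (λ ())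
theorem3p1 1 k 2k+2≤1 = contradiction (m+n≤o⇒n≤o (2 * k) 2k+2≤1) (λ { (s≤s ()) })
theorem3p1 (suc (suc m)) k 2k+2≤n T (tree , count) =
    ≤-trans (≤-reflexive bound≡) (≤-trans (^-monoˡ-≤ 2 (proj₁ minimal)) (≤-reflexive (sym ∏₁≡)))
  , mk⇔ equality⇒sequence sequence⇒equality
  where
  open Parameters (suc (suc m)) k 2k+2≤n
  open ParameterIdentities m k 2k+2≤n
  open TreeDegrees T tree
  open Greedy w using (F)

  ∏₁≡ : ∏₁ T ≡ product (degrees T) ^ 2
  ∏₁≡ = product-map-square (degree T) (allFin (suc (suc m)))

  minimal : suc (suc w) ^ k * F r ≤ product (degrees T) ×
            (product (degrees T) ≡ suc (suc w) ^ k * F r → ∃ λ j → 1 ∷ degrees T ↭ extremal w k r j)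
  minimal = minimal-product w k r r<k (maxDegree T) (degrees T) degrees-positive
    (xs≤max 0 (degrees T)) (trans (length-filter-map (_≟ maxDegree T) (degree T) (allFin (suc (suc m)))) count)
    (trans excess-degrees m≡k*[1+w]+r)

  j = suc (suc m) ∸ k ∸ p ∸ 1

  equality⇒sequence : ∏₁ T ≡ Δ ^ (2 * k) * (Δ ∸ 1) ^ (2 * p) * μ ^ 2 →
    degreeSequence T ≡ replicate k Δ ++ replicate p (Δ ∸ 1) ++ μ ∷ replicate j 1
  equality⇒sequence eq =
    -- Both `∏₁ T` and the bound are squares, so equality descends to the products of the degrees
    -- themselves.
    let _ , 1∷degrees↭ = proj₂ minimal (^2-injective (trans (sym ∏₁≡) (trans eq bound≡)))
    in  trans (sort-unique (extremal-nonIncreasing w k r j)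
                (subst (λ l → degrees T ↭ extremal w k r (l ∸ k ∸ p ∸ 1)) length-degrees
                  (drop-one w k r (subst (k + r <_) (sym length-degrees) k+r<n) 1∷degrees↭)))
              (sym (sequence≡ j))

  sequence⇒equality : degreeSequence T ≡ replicate k Δ ++ replicate p (Δ ∸ 1) ++ μ ∷ replicate j 1 →
    ∏₁ T ≡ Δ ^ (2 * k) * (Δ ∸ 1) ^ (2 * p) * μ ^ 2
  sequence⇒equality eq = begin
    ∏₁ T                                ≡⟨ ∏₁≡ ⟩
    product (degrees T) ^ 2             ≡⟨ cong (_^ 2) (product-↭ (NonIncreasing.sort-↭ (degrees T))) ⟨
    product (degreeSequence T) ^ 2      ≡⟨ cong (λ xs → product xs ^ 2) (trans eq (sequence≡ j)) ⟩
    product (extremal w k r j) ^ 2      ≡⟨ cong (_^ 2) (product-extremal w k r j) ⟩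
    (suc (suc w) ^ k * F r) ^ 2         ≡⟨ bound≡ ⟨
    Δ ^ (2 * k) * (Δ ∸ 1) ^ (2 * p) * μ ^ 2 ∎
    where open ≡-Reasoning
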